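{- For any statements $s,s_*$ and states $\sigma,\sigma_*$, the configurations $(s,\sigma)$ and $(s_*,\sigma_*)$ are weakly bisimilar, $(s,\sigma)\cong(s_*,\sigma_*)$, if and only if there exist resumptions $r$ and $r_*$ such that $(s,\sigma)\Rightarrow r$, $(s_*,\sigma_*)\Rightarrow r_*$ and $r\cong r_*$.
   Context: Language. Given sets of variables $x$ and pure expressions $e$; values are integers; states $\sigma$ map variables to integers; $\sigma[x\mapsto v]$ is state update; $\llbracket e\rrbracket\sigma\in\mathbb Z$ is the value of $e$ in $\sigma$; $\sigma\models e$ means $\llbracket e\rrbracket\sigma\neq 0$. Statements: $s::=\mathsf{skip}\mid s_0;s_1\mid x:=e\mid\mathsf{if}~e~\mathsf{then}~s_t~\mathsf{else}~s_f\mid\mathsf{while}~e~\mathsf{do}~s_t\mid\mathsf{input}~x\mid\mathsf{output}~e$. A configuration is a pair $(s,\sigma)$. Resumptions $r:\mathit{res}$ are defined coinductively by the constructors $\mathit{ret}~\sigma$, $\mathit{in}~f$ ($f:\mathbb Z\to\mathit{res}$), $\mathit{out}~v~r$ ($v\in\mathbb Z$), $\delta~r$. Strong bisimilarity $\approx$ is defined coinductively: $\mathit{ret}~\sigma\approx\mathit{ret}~\sigma$; $\mathit{in}~f\approx\mathit{in}~f_*$ if $\forall v.\,f\,v\approx f_*\,v$; $\mathit{out}~v~r\approx\mathit{out}~v~r_*$ if $r\approx r_*$; $\delta~r\approx\delta~r_*$ if $r\approx r_*$. Strongly bisimilar resumptions count as equal (resumptions form a setoid with equality $\approx$). Convergence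 of resumptions, $r\downarrow r'$, is inductive: $\mathit{ret}~\sigma\downarrow\mathit{ret}~\sigma$; $\mathit{in}~f\downarrow\mathit{in}~f_*$ if $\forall v.\,f\,v\approx f_*\,v$; $\mathit{out}~v~r\downarrow\mathit{out}~v~r_*$ if $r\approx r_*$; $\delta~r\downarrow r'$ if $r\downarrow r'$. Weak bisimilarity of resumptions, $r\cong r_*$, is coinductive: (1) $r\cong r_*$ if $r\downarrow\mathit{ret}~\sigma$ and $r_*\downarrow\mathit{ret}~\sigma$; (2) $r\cong r_*$ if $r\downarrow\mathit{in}~f$, $r_*\downarrow\mathit{in}~f_*$ and $\forall v.\,f\,v\cong f_*\,v$; (3) $r\cong r_*$ if $r\downarrow\mathit{out}~v~r'$, $r_*\downarrow\mathit{out}~v~r_*'$ and $r'\cong r'_*$; (4) $\delta~r\cong\delta~r_*$ if $r\cong r_*$. Big-step semantics. Evaluation $(s,\sigma)\Rightarrow r$ and extended evaluation $(s,r)\stackrel{*}{\Rightarrow}r'$ are defined mutually coinductively by: $(x:=e,\sigma)\Rightarrow\delta(\mathit{ret}~\sigma[x\mapsto\llbracket e\rrbracket\sigma])$; $(\mathsf{skip},\sigma)\Rightarrow\mathit{ret}~\sigma$; $(s_0;s_1,\sigma)\Rightarrow r'$ if $(s_0,\sigma)\Rightarrow r$ and $(s_1,r)\stackrel{*}{\Rightarrow}r'$; $(\mathsf{if}~e~\mathsf{then}~s_t~\mathsf{else}~s_f,\sigma)\Rightarrow r$ if either $\sigma\models e$ and $(s_t,\delta(\mathit{ret}~\sigma))\stackrel{*}{\Rightarrow}r$,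 or $\sigma\not\models e$ and $(s_f,\delta(\mathit{ret}~\sigma))\stackrel{*}{\Rightarrow}r$; $(\mathsf{while}~e~\mathsf{do}~s_t,\sigma)\Rightarrow r'$ if $\sigma\models e$, $(s_t,\delta(\mathit{ret}~\sigma))\stackrel{*}{\Rightarrow}r$ and $(\mathsf{while}~e~\mathsf{do}~s_t,r)\stackrel{*}{\Rightarrow}r'$; $(\mathsf{while}~e~\mathsf{do}~s_t,\sigma)\Rightarrow\delta(\mathit{ret}~\sigma)$ if $\sigma\not\models e$; $(\mathsf{input}~x,\sigma)\Rightarrow\mathit{in}(\lambda v.\,\mathit{ret}~\sigma[x\mapsto v])$; $(\mathsf{output}~e,\sigma)\Rightarrow\mathit{out}~(\llbracket e\rrbracket\sigma)~(\mathit{ret}~\sigma)$; $(s,\mathit{ret}~\sigma)\stackrel{*}{\Rightarrow}r$ if $(s,\sigma)\Rightarrow r$; $(s,\mathit{in}~f)\stackrel{*}{\Rightarrow}\mathit{in}~f'$ if $\forall v.\,(s,f\,v)\stackrel{*}{\Rightarrow}f'\,v$; $(s,\mathit{out}~v~r)\stackrel{*}{\Rightarrow}\mathit{out}~v~r'$ if $(s,r)\stackrel{*}{\Rightarrow}r'$; $(s,\delta~r)\stackrel{*}{\Rightarrow}\delta~r'$ if $(s,r)\stackrel{*}{\Rightarrow}r'$. Small-step semantics. Labelled configurations $c$ are of the forms $\underline{\mathit{ret}}~\sigma$, $\underline{\mathit{in}}~s~g$ ($g:\mathbb Z\to$ states), $\underline{\mathit{out}}~v~s~\sigma$, $\underline{\delta}~s~\sigma$.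 One-step reduction $(s,\sigma)\to c$ is defined inductively: $(x:=e,\sigma)\to\underline\delta~\mathsf{skip}~(\sigma[x\mapsto\llbracket e\rrbracket\sigma])$; $(\mathsf{skip},\sigma)\to\underline{\mathit{ret}}~\sigma$; $(s_0;s_1,\sigma)\to c$ if $(s_0,\sigma)\to\underline{\mathit{ret}}~\sigma'$ and $(s_1,\sigma')\to c$; $(s_0;s_1,\sigma)\to\underline{\mathit{in}}~(s_0';s_1)~g$ if $(s_0,\sigma)\to\underline{\mathit{in}}~s_0'~g$; $(s_0;s_1,\sigma)\to\underline{\mathit{out}}~v~(s_0';s_1)~\sigma'$ if $(s_0,\sigma)\to\underline{\mathit{out}}~v~s_0'~\sigma'$; $(s_0;s_1,\sigma)\to\underline\delta~(s_0';s_1)~\sigma'$ if $(s_0,\sigma)\to\underline\delta~s_0'~\sigma'$; $(\mathsf{if}~e~\mathsf{then}~s_t~\mathsf{else}~s_f,\sigma)\to\underline\delta~s_t~\sigma$ if $\sigma\models e$, and $\to\underline\delta~s_f~\sigma$ if $\sigma\not\models e$; $(\mathsf{while}~e~\mathsf{do}~s_t,\sigma)\to\underline\delta~(s_t;\mathsf{while}~e~\mathsf{do}~s_t)~\sigma$ if $\sigma\models e$, and $\to\underline\delta~\mathsf{skip}~\sigma$ if $\sigma\not\models e$; $(\mathsf{input}~x,\sigma)\to\underline{\mathit{in}}~\mathsf{skip}~(\lambda v.\,\sigma[x\mapsto v])$; $(\mathsf{output}~e,\sigma)\to\underline{\mathit{out}}~(\llbracket e\rrbracket\sigma)~\mathsf{skip}~\sigma$.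 Convergence of configurations, $(s,\sigma)\downarrow c$, is inductive: $(s,\sigma)\downarrow c$ if $(s,\sigma)\to c$ with $c$ of the form $\underline{\mathit{ret}}~\sigma'$, $\underline{\mathit{out}}~v~s'~\sigma'$ or $\underline{\mathit{in}}~s'~g$; and $(s,\sigma)\downarrow c$ if $(s,\sigma)\to\underline\delta~s'~\sigma'$ and $(s',\sigma')\downarrow c$. Weak bisimilarity of configurations, $(s,\sigma)\cong(s_*,\sigma_*)$, is coinductive; it holds if one of: (1) $(s,\sigma)\downarrow\underline{\mathit{ret}}~\sigma'$ and $(s_*,\sigma_*)\downarrow\underline{\mathit{ret}}~\sigma'$; (2) $(s,\sigma)\downarrow\underline{\mathit{in}}~s'~g$, $(s_*,\sigma_*)\downarrow\underline{\mathit{in}}~s'_*~g_*$ and $\forall v.\,(s',g\,v)\cong(s'_*,g_*\,v)$; (3) $(s,\sigma)\downarrow\underline{\mathit{out}}~v~s'~\sigma'$, $(s_*,\sigma_*)\downarrow\underline{\mathit{out}}~v~s'_*~\sigma'_*$ and $(s',\sigma')\cong(s'_*,\sigma'_*)$; (4) $(s,\sigma)\to\underline\delta~s'~\sigma'$, $(s_*,\sigma_*)\to\underline\delta~s'_*~\sigma'_*$ and $(s',\sigma')\cong(s'_*,\sigma'_*)$. -}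

module Defs where

open import Data.Integer.Base using (ℤ; 0ℤ)
open import Data.List.Base using (List; []; _∷_)
open import Data.Product.Base using (_×_; _,_; ∃)
open import Data.Unit.Base using (⊤)
open import Function.Base using (const)
open import Level using (0ℓ; _⊔_) renaming (suc to lsuc)
open import Relation.Binary.Definitions using (DecidableEquality)
open import Relation.Binary.PropositionalEquality.Core using (_≡_; _≢_; refl)
open import Relation.Nullary.Decidable.Core using (yes; no)
open import Relation.Nullary.Negation.Core using (¬_)
open import Relation.Unary using (Pred; _⊆_)

-- Coinductive predicates are greatest fixed points in the Knaster–Tarski
-- sense: the union of all post-fixed points of the rule operator F, which is
-- monotone in every use below.  Predicativity forces a choice of the level ℓ
-- of the post-fixed points.

ν : ∀ {ℓ ℓ′} {A : Set} → (Pred A ℓ → Pred A ℓ′) → Pred A (lsuc ℓ ⊔ ℓ′)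
ν F x = ∃ λ R → R ⊆ F R × R x

record Language : Set₁ where
  field
    Var  : Set
    _≟_  : DecidableEquality Var
    Expr : Set
    ⟦_⟧  : Expr → (Var → ℤ) → ℤ

module Semantics (L : Language) where

  open Language L

  State : Set
  State = Var → ℤ

  infixl 9 _[_↦_]
  _[_↦_] : State → Var → ℤ → State
  (σ [ x ↦ v ]) y with y ≟ x
  ... | yes _ = v
  ... | no  _ = σ y

  infix 4 _⊨_ _⊭_
  _⊨_ _⊭_ : State → Expr → Set
  σ ⊨ e = ⟦ e ⟧ σ ≢ 0ℤ
  σ ⊭ e = ¬ (σ ⊨ e)

  infixr 5 _⨾_
  infix  6 _:=_
  data Stmt : Set where
    skip          : Stmt
    _⨾_           : Stmt → Stmt → Stmt
    _:=_          : Var → Expr → Stmt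
    if_then_else_ : Expr → Stmt → Stmt → Stmt
    while_do′_    : Expr → Stmt → Stmt
    input         : Var → Stmt
    output        : Expr → Stmt

  Config : Set
  Config = Stmt × State

  ----------------------------------------------------------------------
  -- Resumptions

  data Layer (X : Set) : Set where
    retᴸ : State → Layer X
    inᴸ  : (ℤ → X) → Layer X
    outᴸ : ℤ → X → Layer X
    δᴸ   : X → Layer X

  mapᴸ : ∀ {X Y} → (X → Y) → Layer X → Layer Y
  mapᴸ h (retᴸ σ)   = retᴸ σ
  mapᴸ h (inᴸ f)    = inᴸ (λ v → h (f v))
  mapᴸ h (outᴸ v x) = outᴸ v (h x)
  mapᴸ h (δᴸ x)     = δᴸ (h x)

  -- A possibly infinite tree, given by its node label at each path from the
  -- root; Layer ⊤ is the type of node labels.  One integer is consumed per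
  -- edge: an `in` node branches on it, `out` and `δ` nodes ignore it.  Labels
  -- at paths through no actual edge (below a `ret`, or reached by different
  -- integers below `out` and `δ`) are junk, which _≈_ disregards; up to _≈_
  -- this is the final coalgebra of Layer.

  Res : Set
  Res = List ℤ → Layer ⊤

  unfold : Res → Layer Res
  unfold r with r []
  ... | retᴸ σ   = retᴸ σ
  ... | inᴸ _    = inᴸ (λ v p → r (v ∷ p))
  ... | outᴸ v _ = outᴸ v (λ p → r (0ℤ ∷ p))
  ... | δᴸ _     = δᴸ (λ p → r (0ℤ ∷ p))

  ret : State → Res
  ret σ _ = retᴸ σ

  in′ : (ℤ → Res) → Res
  in′ f []      = inᴸ _
  in′ f (v ∷ p) = f v p

  out : ℤ → Res → Res
  out v r []      = outᴸ v _
  out v r (_ ∷ p) = r p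

  δ : Res → Res
  δ r []      = δᴸ _
  δ r (_ ∷ p) = r p

  unfold-ret : ∀ σ → unfold (ret σ) ≡ retᴸ σ
  unfold-ret _ = refl

  unfold-in : ∀ f → unfold (in′ f) ≡ inᴸ f
  unfold-in _ = refl

  unfold-out : ∀ v r → unfold (out v r) ≡ outᴸ v r
  unfold-out _ _ = refl

  unfold-δ : ∀ r → unfold (δ r) ≡ δᴸ r
  unfold-δ _ = refl

  -- Corecursion into Res, and its computation rule.

  walk : ∀ {X} → (X → Layer X) → Layer X → Res
  walk c l          []      = mapᴸ (const _) l
  walk c (retᴸ σ)   (_ ∷ p) = retᴸ σ
  walk c (inᴸ f)    (v ∷ p) = walk c (c (f v)) p
  walk c (outᴸ _ x) (_ ∷ p) = walk c (c x) p
  walk c (δᴸ x)     (_ ∷ p) = walk c (c x) p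

  unfoldr : ∀ {X} → (X → Layer X) → X → Res
  unfoldr c x = walk c (c x)

  unfold-unfoldr : ∀ {X} (c : X → Layer X) x →
                   unfold (unfoldr c x) ≡ mapᴸ (unfoldr c) (c x)
  unfold-unfoldr c x with c x
  ... | retᴸ _   = refl
  ... | inᴸ _    = refl
  ... | outᴸ _ _ = refl
  ... | δᴸ _     = refl

  data ≈-Rule (R : Pred (Res × Res) 0ℓ) : Layer Res → Layer Res → Set where
    ret≈ : ∀ {σ} → ≈-Rule R (retᴸ σ) (retᴸ σ)
    in≈  : ∀ {f f∗} → (∀ v → R (f v , f∗ v)) → ≈-Rule R (inᴸ f) (inᴸ f∗)
    out≈ : ∀ {v r r∗} → R (r , r∗) → ≈-Rule R (outᴸ v r) (outᴸ v r∗)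
    δ≈   : ∀ {r r∗} → R (r , r∗) → ≈-Rule R (δᴸ r) (δᴸ r∗)

  infix 4 _≈_ _↓_ _≅_
  _≈_ : Res → Res → Set₁
  r ≈ r∗ = ν (λ R (r , r∗) → ≈-Rule R (unfold r) (unfold r∗)) (r , r∗)

  -- Resumptions are a setoid under _≈_.  From here on, a rule about a
  -- resumption built by some constructor is stated for every resumption that
  -- is strongly bisimilar to one so built.

  data _↓_ : Res → Res → Set₁ where
    ret↓ : ∀ {r r′ σ} → r ≈ ret σ → r′ ≈ ret σ → r ↓ r′
    in↓  : ∀ {r r′ f f∗} → r ≈ in′ f → r′ ≈ in′ f∗ →
           (∀ v → f v ≈ f∗ v) → r ↓ r′
    out↓ : ∀ {r r′ v r₀ r₀∗} → r ≈ out v r₀ → r′ ≈ out v r₀∗ →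
           r₀ ≈ r₀∗ → r ↓ r′
    δ↓   : ∀ {r r′ r₀} → r ≈ δ r₀ → r₀ ↓ r′ → r ↓ r′

  data ≅-Rule (R : Pred (Res × Res) (lsuc 0ℓ)) : Pred (Res × Res) (lsuc 0ℓ) where
    ret≅ : ∀ {r r∗ σ} → r ↓ ret σ → r∗ ↓ ret σ → ≅-Rule R (r , r∗)
    in≅  : ∀ {r r∗ f f∗} → r ↓ in′ f → r∗ ↓ in′ f∗ →
           (∀ v → R (f v , f∗ v)) → ≅-Rule R (r , r∗)
    out≅ : ∀ {r r∗ v r′ r∗′} → r ↓ out v r′ → r∗ ↓ out v r∗′ →
           R (r′ , r∗′) → ≅-Rule R (r , r∗)
    δ≅   : ∀ {r r∗ r′ r∗′} → r ≈ δ r′ → r∗ ≈ δ r∗′ →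
           R (r′ , r∗′) → ≅-Rule R (r , r∗)

  _≅_ : Res → Res → Set₂
  r ≅ r∗ = ν ≅-Rule (r , r∗)

  ----------------------------------------------------------------------
  -- Big-step semantics

  -- The two relations are mutually coinductive, hence one greatest fixed
  -- point over the judgements of both forms.

  data Judgement : Set where
    eval  : Config → Res → Judgement
    eval* : Stmt × Res → Res → Judgement

  data Eval-Rule (R : Pred Judgement (lsuc 0ℓ)) : Pred Judgement (lsuc 0ℓ) where
    assign   : ∀ {x e σ r} → r ≈ δ (ret (σ [ x ↦ ⟦ e ⟧ σ ])) →
               Eval-Rule R (eval (x := e , σ) r)
    skip     : ∀ {σ r} → r ≈ ret σ → Eval-Rule R (eval (skip , σ) r)
    seq      : ∀ {s₀ s₁ σ r r′} → R (eval (s₀ , σ) r) → R (eval* (s₁ , r) r′) →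
               Eval-Rule R (eval (s₀ ⨾ s₁ , σ) r′)
    if-tt    : ∀ {e sₜ sf σ r} → σ ⊨ e → R (eval* (sₜ , δ (ret σ)) r) →
               Eval-Rule R (eval (if e then sₜ else sf , σ) r)
    if-ff    : ∀ {e sₜ sf σ r} → σ ⊭ e → R (eval* (sf , δ (ret σ)) r) →
               Eval-Rule R (eval (if e then sₜ else sf , σ) r)
    while-tt : ∀ {e sₜ σ r r′} → σ ⊨ e → R (eval* (sₜ , δ (ret σ)) r) →
               R (eval* (while e do′ sₜ , r) r′) →
               Eval-Rule R (eval (while e do′ sₜ , σ) r′)
    while-ff : ∀ {e sₜ σ r} → σ ⊭ e → r ≈ δ (ret σ) →
               Eval-Rule R (eval (while e do′ sₜ , σ) r)
    input    : ∀ {x σ r} → r ≈ in′ (λ v → ret (σ [ x ↦ v ])) →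
               Eval-Rule R (eval (input x , σ) r)
    output   : ∀ {e σ r} → r ≈ out (⟦ e ⟧ σ) (ret σ) →
               Eval-Rule R (eval (output e , σ) r)
    ret*     : ∀ {s r σ r′} → r ≈ ret σ → R (eval (s , σ) r′) →
               Eval-Rule R (eval* (s , r) r′)
    in*      : ∀ {s r r′ f f′} → r ≈ in′ f → r′ ≈ in′ f′ →
               (∀ v → R (eval* (s , f v) (f′ v))) → Eval-Rule R (eval* (s , r) r′)
    out*     : ∀ {s r r′ v r₀ r₀′} → r ≈ out v r₀ → r′ ≈ out v r₀′ →
               R (eval* (s , r₀) r₀′) → Eval-Rule R (eval* (s , r) r′)
    δ*       : ∀ {s r r′ r₀ r₀′} → r ≈ δ r₀ → r′ ≈ δ r₀′ →
               R (eval* (s , r₀) r₀′) → Eval-Rule R (eval* (s , r) r′)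

  infix 4 _⇒_ _⇒*_
  _⇒_ : Config → Res → Set₂
  c ⇒ r = ν Eval-Rule (eval c r)

  _⇒*_ : Stmt × Res → Res → Set₂
  sr ⇒* r′ = ν Eval-Rule (eval* sr r′)

  ----------------------------------------------------------------------
  -- Small-step semantics

  data Labelled : Set where
    retᶜ : State → Labelled
    inᶜ  : Stmt → (ℤ → State) → Labelled
    outᶜ : ℤ → Stmt → State → Labelled
    δᶜ   : Stmt → State → Labelled

  infix 4 _⟶_ _↓ᶜ_ _≅ᶜ_
  data _⟶_ : Config → Labelled → Set where
    assign   : ∀ {x e σ} → (x := e , σ) ⟶ δᶜ skip (σ [ x ↦ ⟦ e ⟧ σ ])
    skip     : ∀ {σ} → (skip , σ) ⟶ retᶜ σ
    seq-ret  : ∀ {s₀ s₁ σ σ′ c} → (s₀ , σ) ⟶ retᶜ σ′ → (s₁ , σ′) ⟶ c →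
               (s₀ ⨾ s₁ , σ) ⟶ c
    seq-in   : ∀ {s₀ s₁ σ s₀′ g} → (s₀ , σ) ⟶ inᶜ s₀′ g →
               (s₀ ⨾ s₁ , σ) ⟶ inᶜ (s₀′ ⨾ s₁) g
    seq-out  : ∀ {s₀ s₁ σ v s₀′ σ′} → (s₀ , σ) ⟶ outᶜ v s₀′ σ′ →
               (s₀ ⨾ s₁ , σ) ⟶ outᶜ v (s₀′ ⨾ s₁) σ′
    seq-δ    : ∀ {s₀ s₁ σ s₀′ σ′} → (s₀ , σ) ⟶ δᶜ s₀′ σ′ →
               (s₀ ⨾ s₁ , σ) ⟶ δᶜ (s₀′ ⨾ s₁) σ′
    if-tt    : ∀ {e sₜ sf σ} → σ ⊨ e → (if e then sₜ else sf , σ) ⟶ δᶜ sₜ σ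
    if-ff    : ∀ {e sₜ sf σ} → σ ⊭ e → (if e then sₜ else sf , σ) ⟶ δᶜ sf σ
    while-tt : ∀ {e sₜ σ} → σ ⊨ e →
               (while e do′ sₜ , σ) ⟶ δᶜ (sₜ ⨾ while e do′ sₜ) σ
    while-ff : ∀ {e sₜ σ} → σ ⊭ e → (while e do′ sₜ , σ) ⟶ δᶜ skip σ
    input    : ∀ {x σ} → (input x , σ) ⟶ inᶜ skip (λ v → σ [ x ↦ v ])
    output   : ∀ {e σ} → (output e , σ) ⟶ outᶜ (⟦ e ⟧ σ) skip σ

  data _↓ᶜ_ : Config → Labelled → Set where
    ret↓ : ∀ {c σ′} → c ⟶ retᶜ σ′ → c ↓ᶜ retᶜ σ′
    out↓ : ∀ {c v s′ σ′} → c ⟶ outᶜ v s′ σ′ → c ↓ᶜ outᶜ v s′ σ′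
    in↓  : ∀ {c s′ g} → c ⟶ inᶜ s′ g → c ↓ᶜ inᶜ s′ g
    δ↓   : ∀ {c s′ σ′ c′} → c ⟶ δᶜ s′ σ′ → (s′ , σ′) ↓ᶜ c′ → c ↓ᶜ c′

  data ≅ᶜ-Rule (R : Pred (Config × Config) (lsuc 0ℓ)) :
               Pred (Config × Config) (lsuc 0ℓ) where
    ret≅ : ∀ {c c∗ σ′} → c ↓ᶜ retᶜ σ′ → c∗ ↓ᶜ retᶜ σ′ → ≅ᶜ-Rule R (c , c∗)
    in≅  : ∀ {c c∗ s′ s∗′ g g∗} → c ↓ᶜ inᶜ s′ g → c∗ ↓ᶜ inᶜ s∗′ g∗ →
           (∀ v → R ((s′ , g v) , (s∗′ , g∗ v))) → ≅ᶜ-Rule R (c , c∗)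
    out≅ : ∀ {c c∗ v s′ s∗′ σ′ σ∗′} → c ↓ᶜ outᶜ v s′ σ′ → c∗ ↓ᶜ outᶜ v s∗′ σ∗′ →
           R ((s′ , σ′) , (s∗′ , σ∗′)) → ≅ᶜ-Rule R (c , c∗)
    δ≅   : ∀ {c c∗ s′ s∗′ σ′ σ∗′} → c ⟶ δᶜ s′ σ′ → c∗ ⟶ δᶜ s∗′ σ∗′ →
           R ((s′ , σ′) , (s∗′ , σ∗′)) → ≅ᶜ-Rule R (c , c∗)

  _≅ᶜ_ : Config → Config → Set₂
  c ≅ᶜ c∗ = ν ≅ᶜ-Rule (c , c∗)

{-# OPTIONS --safe #-}
-- Reduction is deterministic and total, so each configuration c has a trace
-- run c, the resumption unfolded from it.  Then c ⇒ run c, and c ⇒ r forces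
-- r ≈ run c, so the theorem reduces to c ≅ᶜ c∗ ⇔ run c ≅ run c∗.  Evaluation
-- and _≅_ live one universe too high to serve as post-fixed points for _≈_ and
-- _≅ᶜ_: uniqueness is therefore proved for the finite approximations of _≈_,
-- and the equivalence by transporting the post-fixed point that is given.
module Submission where

open import Defs
open import Data.Integer.Base using (0ℤ)
import Data.Integer.Properties as ℤ
open import Data.List.Base using ([]; _∷_)
open import Data.Nat.Base using (ℕ; zero; suc)
open import Data.Product.Base using (_×_; _,_; ∃-syntax)
open import Function.Bundles using (_⇔_; mk⇔)
open import Level using (0ℓ) renaming (suc to lsuc)
open import Relation.Binary.PropositionalEquality
  using (_≡_; refl; sym; trans; cong; subst)
open import Relation.Nullary using (Dec; yes; no; ¬?; contradiction)
open import Relation.Unary using (Pred; _⊆_)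

module Traces (L : Language) where

  open Language L
  open Semantics L

  -- Strong bisimilarity

  infix 4 _≈[_]_
  -- Agreement down to depth `n`. Since it lives in `Set`, its intersection over all `n` can serve
  -- as a post-fixed point for `_≈_`, and coinductive arguments become inductions on `n`.
  data _≈[_]_ : Res → ℕ → Res → Set where
    zero : ∀ {r r∗} → r ≈[ zero ] r∗
    suc  : ∀ {n r r∗} → ≈-Rule (λ (r , r∗) → r ≈[ n ] r∗) (unfold r) (unfold r∗) →
           r ≈[ suc n ] r∗

  unfold≡⇒≈-Rule : ∀ {R l l∗} → (∀ {r} → R (r , r)) → l ≡ l∗ → ≈-Rule R l l∗
  unfold≡⇒≈-Rule {l = retᴸ σ}   R-refl refl = ret≈
  unfold≡⇒≈-Rule {l = inᴸ f}    R-refl refl = in≈ λ _ → R-refl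
  unfold≡⇒≈-Rule {l = outᴸ v r} R-refl refl = out≈ R-refl
  unfold≡⇒≈-Rule {l = δᴸ r}     R-refl refl = δ≈ R-refl

  ≈-Rule-sym : ∀ {R l l∗} → (∀ {r r∗} → R (r , r∗) → R (r∗ , r)) →
               ≈-Rule R l l∗ → ≈-Rule R l∗ l
  ≈-Rule-sym R-sym ret≈     = ret≈
  ≈-Rule-sym R-sym (in≈ p)  = in≈ λ v → R-sym (p v)
  ≈-Rule-sym R-sym (out≈ p) = out≈ (R-sym p)
  ≈-Rule-sym R-sym (δ≈ p)   = δ≈ (R-sym p)

  ≈-Rule-trans : ∀ {R l l′ l″} →
                 (∀ {r r′ r″} → R (r , r′) → R (r′ , r″) → R (r , r″)) →
                 ≈-Rule R l l′ → ≈-Rule R l′ l″ → ≈-Rule R l l″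
  ≈-Rule-trans R-trans ret≈     ret≈     = ret≈
  ≈-Rule-trans R-trans (in≈ p)  (in≈ q)  = in≈ λ v → R-trans (p v) (q v)
  ≈-Rule-trans R-trans (out≈ p) (out≈ q) = out≈ (R-trans p q)
  ≈-Rule-trans R-trans (δ≈ p)   (δ≈ q)   = δ≈ (R-trans p q)

  ≈-Rule-map : ∀ {R S l l∗} → R ⊆ S → ≈-Rule R l l∗ → ≈-Rule S l l∗
  ≈-Rule-map R⊆S ret≈     = ret≈
  ≈-Rule-map R⊆S (in≈ p)  = in≈ λ v → R⊆S (p v)
  ≈-Rule-map R⊆S (out≈ p) = out≈ (R⊆S p)
  ≈-Rule-map R⊆S (δ≈ p)   = δ≈ (R⊆S p)

  -- With both layers fixed, only one constructor fits, so the one found at index 0 recurs at every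
  -- index. This continuity of the rule operator is why finite depths determine `_≈_`.
  ≈-Rule-⋂ : ∀ {R : ℕ → Pred (Res × Res) 0ℓ} {l l∗} →
             (∀ n → ≈-Rule (R n) l l∗) → ≈-Rule (λ rr∗ → ∀ n → R n rr∗) l l∗
  ≈-Rule-⋂ p with p 0
  ... | ret≈   = ret≈
  ... | in≈ _  = in≈ λ v n → case-in (p n) v
    where
    case-in : ∀ {R f f∗} → ≈-Rule R (inᴸ f) (inᴸ f∗) → ∀ v → R (f v , f∗ v)
    case-in (in≈ q) = q
  ... | out≈ _ = out≈ λ n → case-out (p n)
    where
    case-out : ∀ {R v r r∗} → ≈-Rule R (outᴸ v r) (outᴸ v r∗) → R (r , r∗)
    case-out (out≈ q) = q
  ... | δ≈ _   = δ≈ λ n → case-δ (p n)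
    where
    case-δ : ∀ {R r r∗} → ≈-Rule R (δᴸ r) (δᴸ r∗) → R (r , r∗)
    case-δ (δ≈ q) = q

  ≈[]-refl : ∀ {n r} → r ≈[ n ] r
  ≈[]-refl {zero}  = zero
  ≈[]-refl {suc n} = suc (unfold≡⇒≈-Rule ≈[]-refl refl)

  ≈[]-sym : ∀ {n r r∗} → r ≈[ n ] r∗ → r∗ ≈[ n ] r
  ≈[]-sym zero    = zero
  ≈[]-sym (suc p) = suc (≈-Rule-sym ≈[]-sym p)

  ≈[]-trans : ∀ {n r r′ r″} → r ≈[ n ] r′ → r′ ≈[ n ] r″ → r ≈[ n ] r″
  ≈[]-trans zero    zero    = zero
  ≈[]-trans (suc p) (suc q) = suc (≈-Rule-trans ≈[]-trans p q)

  ≈⇒≈[] : ∀ {r r∗} → r ≈ r∗ → ∀ n → r ≈[ n ] r∗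
  ≈⇒≈[] p                zero    = zero
  ≈⇒≈[] (R , R-post , p) (suc n) =
    suc (≈-Rule-map (λ q → ≈⇒≈[] (R , R-post , q) n) (R-post p))

  ≈[]⇒≈-Rule : ∀ {r r∗} → (∀ n → r ≈[ n ] r∗) →
               ≈-Rule (λ (r , r∗) → ∀ n → r ≈[ n ] r∗) (unfold r) (unfold r∗)
  ≈[]⇒≈-Rule {r} {r∗} p = ≈-Rule-⋂ λ n → peel (p (suc n))
    where
    peel : ∀ {n} → r ≈[ suc n ] r∗ →
           ≈-Rule (λ (r , r∗) → r ≈[ n ] r∗) (unfold r) (unfold r∗)
    peel (suc q) = q

  ≈[]⇒≈ : ∀ {r r∗} → (∀ n → r ≈[ n ] r∗) → r ≈ r∗
  ≈[]⇒≈ p = _ , ≈[]⇒≈-Rule , p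

  -- Inversion of a bisimilarity. `_≈_` is one universe too large to be an argument of `≈-Rule`, so
  -- the children are related by the intersection of the approximations, from which `≈[]⇒≈` leads
  -- back.
  ≈⇒≈-Rule : ∀ {r r∗} → r ≈ r∗ →
             ≈-Rule (λ (r , r∗) → ∀ n → r ≈[ n ] r∗) (unfold r) (unfold r∗)
  ≈⇒≈-Rule p = ≈[]⇒≈-Rule (≈⇒≈[] p)

  unfold≡⇒≈ : ∀ {r r∗} → unfold r ≡ unfold r∗ → r ≈ r∗
  unfold≡⇒≈ {r} {r∗} eq = ≈[]⇒≈ approx
    where
    approx : ∀ n → r ≈[ n ] r∗
    approx zero    = zero
    approx (suc n) = suc (unfold≡⇒≈-Rule ≈[]-refl eq)

  ≈-refl : ∀ {r} → r ≈ r
  ≈-refl = unfold≡⇒≈ refl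

  ≈-sym : ∀ {r r∗} → r ≈ r∗ → r∗ ≈ r
  ≈-sym p = ≈[]⇒≈ λ n → ≈[]-sym (≈⇒≈[] p n)

  ≈-trans : ∀ {r r′ r″} → r ≈ r′ → r′ ≈ r″ → r ≈ r″
  ≈-trans p q = ≈[]⇒≈ λ n → ≈[]-trans (≈⇒≈[] p n) (≈⇒≈[] q n)

  δ-cong[] : ∀ {n r r∗} → r ≈[ n ] r∗ → δ r ≈[ suc n ] δ r∗
  δ-cong[] p = suc (δ≈ p)

  δ-cong : ∀ {r r∗} → r ≈ r∗ → δ r ≈ δ r∗
  δ-cong {r} {r∗} p = ≈[]⇒≈ approx
    where
    approx : ∀ n → δ r ≈[ n ] δ r∗
    approx zero    = zero
    approx (suc n) = δ-cong[] (≈⇒≈[] p n)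

  out-cong : ∀ {v r r∗} → r ≈ r∗ → out v r ≈ out v r∗
  out-cong {v} {r} {r∗} p = ≈[]⇒≈ approx
    where
    approx : ∀ n → out v r ≈[ n ] out v r∗
    approx zero    = zero
    approx (suc n) = suc (out≈ (≈⇒≈[] p n))

  in-cong : ∀ {f f∗} → (∀ v → f v ≈ f∗ v) → in′ f ≈ in′ f∗
  in-cong {f} {f∗} p = ≈[]⇒≈ approx
    where
    approx : ∀ n → in′ f ≈[ n ] in′ f∗
    approx zero    = zero
    approx (suc n) = suc (in≈ λ v → ≈⇒≈[] (p v) n)

  fold : Layer Res → Res
  fold (retᴸ σ)   = ret σ
  fold (inᴸ f)    = in′ f
  fold (outᴸ v r) = out v r
  fold (δᴸ r)     = δ r

  unfold-fold : ∀ l → unfold (fold l) ≡ l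
  unfold-fold (retᴸ σ)   = refl
  unfold-fold (inᴸ f)    = refl
  unfold-fold (outᴸ v r) = refl
  unfold-fold (δᴸ r)     = refl

  -- The semantic rules ask for bisimilarity to a constructor form; this provides one for any
  -- resumption.
  fold-unfold : ∀ r → r ≈ fold (unfold r)
  fold-unfold r = unfold≡⇒≈ (sym (unfold-fold (unfold r)))

  -- Reduction as a function

  _⊨?_ : ∀ σ e → Dec (σ ⊨ e)
  σ ⊨? e = ¬? (⟦ e ⟧ σ ℤ.≟ 0ℤ)

  -- When `s₀` returns, `seq-ret` continues into `s₁` within the same step. Both are subterms of
  -- `s₀ ⨾ s₁`, so the mutual recursion with `_▷ᶜ_` is structural in the statement.
  next : Stmt → State → Labelled
  _▷ᶜ_ : Labelled → Stmt → Labelled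

  next skip                   σ = retᶜ σ
  next (s₀ ⨾ s₁)              σ = next s₀ σ ▷ᶜ s₁
  next (x := e)               σ = δᶜ skip (σ [ x ↦ ⟦ e ⟧ σ ])
  next (if e then sₜ else sf) σ with σ ⊨? e
  ... | yes _ = δᶜ sₜ σ
  ... | no  _ = δᶜ sf σ
  next (while e do′ sₜ)       σ with σ ⊨? e
  ... | yes _ = δᶜ (sₜ ⨾ while e do′ sₜ) σ
  ... | no  _ = δᶜ skip σ
  next (input x)              σ = inᶜ skip (λ v → σ [ x ↦ v ])
  next (output e)             σ = outᶜ (⟦ e ⟧ σ) skip σ

  retᶜ σ      ▷ᶜ s = next s σ
  inᶜ s′ g    ▷ᶜ s = inᶜ (s′ ⨾ s) g
  outᶜ v s′ σ ▷ᶜ s = outᶜ v (s′ ⨾ s) σ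
  δᶜ s′ σ     ▷ᶜ s = δᶜ (s′ ⨾ s) σ

  next-sound : ∀ s σ → (s , σ) ⟶ next s σ
  next-sound skip      σ = skip
  next-sound (s₀ ⨾ s₁) σ with next s₀ σ | next-sound s₀ σ
  ... | retᶜ σ′     | p = seq-ret p (next-sound s₁ σ′)
  ... | inᶜ _ _     | p = seq-in p
  ... | outᶜ _ _ _  | p = seq-out p
  ... | δᶜ _ _      | p = seq-δ p
  next-sound (x := e) σ = assign
  next-sound (if e then sₜ else sf) σ with σ ⊨? e
  ... | yes σ⊨e = if-tt σ⊨e
  ... | no  σ⊭e = if-ff σ⊭e
  next-sound (while e do′ sₜ) σ with σ ⊨? e
  ... | yes σ⊨e = while-tt σ⊨e
  ... | no  σ⊭e = while-ff σ⊭e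
  next-sound (input x)  σ = input
  next-sound (output e) σ = output

  -- Determinism of reduction, as `next-sound` is its totality. Where a rule tests an expression,
  -- the opposite answer of `_⊨?_` contradicts its premise.
  next-complete : ∀ {s σ l} → (s , σ) ⟶ l → next s σ ≡ l
  next-complete assign        = refl
  next-complete skip          = refl
  next-complete (seq-ret {s₁ = s₁} p q) =
    trans (cong (_▷ᶜ s₁) (next-complete p)) (next-complete q)
  next-complete (seq-in {s₁ = s₁} p)  = cong (_▷ᶜ s₁) (next-complete p)
  next-complete (seq-out {s₁ = s₁} p) = cong (_▷ᶜ s₁) (next-complete p)
  next-complete (seq-δ {s₁ = s₁} p)   = cong (_▷ᶜ s₁) (next-complete p)
  next-complete (if-tt {e} {σ = σ} σ⊨e) with σ ⊨? e
  ... | yes _   = refl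
  ... | no  σ⊭e = contradiction σ⊨e σ⊭e
  next-complete (if-ff {e} {σ = σ} σ⊭e) with σ ⊨? e
  ... | yes σ⊨e = contradiction σ⊨e σ⊭e
  ... | no  _   = refl
  next-complete (while-tt {e} {σ = σ} σ⊨e) with σ ⊨? e
  ... | yes _   = refl
  ... | no  σ⊭e = contradiction σ⊨e σ⊭e
  next-complete (while-ff {e} {σ = σ} σ⊭e) with σ ⊨? e
  ... | yes σ⊨e = contradiction σ⊨e σ⊭e
  ... | no  _   = refl
  next-complete input         = refl
  next-complete output        = refl

  -- Traces

  layer : Labelled → Layer Config
  layer (retᶜ σ)     = retᴸ σ
  layer (inᶜ s g)    = inᴸ (λ v → s , g v)
  layer (outᶜ v s σ) = outᴸ v (s , σ)
  layer (δᶜ s σ)     = δᴸ (s , σ)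

  -- Opaque, since run (s , σ) would otherwise reduce to a form from which s
  -- and σ cannot be inferred.
  opaque
    run : Config → Res
    run = unfoldr (λ (s , σ) → layer (next s σ))

  runᶜ : Labelled → Res
  runᶜ (retᶜ σ)     = ret σ
  runᶜ (inᶜ s g)    = in′ (λ v → run (s , g v))
  runᶜ (outᶜ v s σ) = out v (run (s , σ))
  runᶜ (δᶜ s σ)     = δ (run (s , σ))

  opaque
    unfolding run

    run-next : ∀ s σ → run (s , σ) ≈ runᶜ (next s σ)
    run-next s σ = unfold≡⇒≈ (trans (unfold-unfoldr _ (s , σ)) (mapᴸ-run (next s σ)))
      where
      mapᴸ-run : ∀ l → mapᴸ run (layer l) ≡ unfold (runᶜ l)
      mapᴸ-run (retᶜ σ)     = refl
      mapᴸ-run (inᶜ s g)    = refl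
      mapᴸ-run (outᶜ v s σ) = refl
      mapᴸ-run (δᶜ s σ)     = refl

  run-⟶ : ∀ {s σ l} → (s , σ) ⟶ l → run (s , σ) ≈ runᶜ l
  run-⟶ {s} {σ} p = subst (λ l → run (s , σ) ≈ runᶜ l) (next-complete p) (run-next s σ)

  run-skip : ∀ σ → run (skip , σ) ≈ ret σ
  run-skip = run-next skip

  -- The result of extended evaluation

  infixl 6 _▷_ _▷ᴸ_
  -- Grafts the trace of `s` onto every leaf. Recursion on the path makes a grafted leaf literally a
  -- `run`; `unfoldr` would need states that are either resumptions or configurations.
  _▷ᴸ_ : Layer Res → Stmt → Res
  (retᴸ σ ▷ᴸ s)   p       = run (s , σ) p
  (inᴸ f ▷ᴸ s)    []      = inᴸ _
  (inᴸ f ▷ᴸ s)    (v ∷ p) = (unfold (f v) ▷ᴸ s) p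
  (outᴸ v r ▷ᴸ s) []      = outᴸ v _
  (outᴸ v r ▷ᴸ s) (_ ∷ p) = (unfold r ▷ᴸ s) p
  (δᴸ r ▷ᴸ s)     []      = δᴸ _
  (δᴸ r ▷ᴸ s)     (_ ∷ p) = (unfold r ▷ᴸ s) p

  _▷_ : Res → Stmt → Res
  r ▷ s = unfold r ▷ᴸ s

  ▷-in : ∀ f s → in′ f ▷ s ≈ in′ (λ v → f v ▷ s)
  ▷-in f s = unfold≡⇒≈ refl

  ▷-out : ∀ v r s → out v r ▷ s ≈ out v (r ▷ s)
  ▷-out v r s = unfold≡⇒≈ refl

  ▷-δ : ∀ r s → δ r ▷ s ≈ δ (r ▷ s)
  ▷-δ r s = unfold≡⇒≈ refl

  -- Grafting copies inner nodes one for one and replaces equal leaves by equal traces, so it is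
  -- non-expansive: no depth is lost.
  ▷-cong[] : ∀ {n r r∗} s → r ≈[ n ] r∗ → r ▷ s ≈[ n ] r∗ ▷ s
  ▷-cong[] s zero        = zero
  ▷-cong[] s (suc {n} p) = ▷ᴸ-cong p
    where
    ▷ᴸ-cong : ∀ {l l∗} → ≈-Rule (λ (r , r∗) → r ≈[ n ] r∗) l l∗ →
              l ▷ᴸ s ≈[ suc n ] l∗ ▷ᴸ s
    ▷ᴸ-cong ret≈     = ≈[]-refl
    ▷ᴸ-cong (in≈ p)  = suc (in≈ λ v → ▷-cong[] s (p v))
    ▷ᴸ-cong (out≈ p) = suc (out≈ (▷-cong[] s p))
    ▷ᴸ-cong (δ≈ p)   = suc (δ≈ (▷-cong[] s p))

  ▷-cong : ∀ {r r∗} s → r ≈ r∗ → r ▷ s ≈ r∗ ▷ s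
  ▷-cong s p = ≈[]⇒≈ λ n → ▷-cong[] s (≈⇒≈[] p n)

  run-⨾ : ∀ s₀ s₁ σ → run (s₀ ⨾ s₁ , σ) ≈ run (s₀ , σ) ▷ s₁
  run-⨾ s₀ s₁ σ = ≈[]⇒≈ λ n → approx n s₀ σ
    where
    -- Generalised over the first statement, since a step leaves a residual `s′ ⨾ s₁`. Depth drops
    -- at each visible node; on a return both sides continue as the trace of `s₁`.
    approx  : ∀ n s σ → run (s ⨾ s₁ , σ) ≈[ n ] run (s , σ) ▷ s₁
    approxᶜ : ∀ n l → runᶜ (l ▷ᶜ s₁) ≈[ n ] runᶜ l ▷ s₁

    approx n s σ =
      ≈[]-trans (≈⇒≈[] (run-next (s ⨾ s₁) σ) n)
        (≈[]-trans (approxᶜ n (next s σ))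
          (≈[]-sym (≈⇒≈[] (▷-cong s₁ (run-next s σ)) n)))

    approxᶜ zero    l            = zero
    approxᶜ (suc n) (retᶜ σ)     = ≈[]-sym (≈⇒≈[] (run-next s₁ σ) (suc n))
    approxᶜ (suc n) (inᶜ s g)    = suc (in≈ λ v → approx n s (g v))
    approxᶜ (suc n) (outᶜ v s σ) = suc (out≈ (approx n s σ))
    approxᶜ (suc n) (δᶜ s σ)     = suc (δ≈ (approx n s σ))

  run-while : ∀ {e σ} sₜ → σ ⊨ e →
              run (while e do′ sₜ , σ) ≈ δ (run (sₜ , σ) ▷ while e do′ sₜ)
  run-while sₜ σ⊨e = ≈-trans (run-⟶ (while-tt σ⊨e)) (δ-cong (run-⨾ sₜ _ _))

  -- Big-step evaluation computes exactly the trace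

  -- The post-fixed point behind existence of evaluations. Its level is exactly that of `_≈_`, so it
  -- can be closed under bisimilarity of the result.
  data IsTrace : Pred Judgement (lsuc 0ℓ) where
    eval  : ∀ {s σ r} → r ≈ run (s , σ) → IsTrace (eval (s , σ) r)
    eval* : ∀ {s r r′} → r′ ≈ r ▷ s → IsTrace (eval* (s , r) r′)

  IsTrace-post : IsTrace ⊆ Eval-Rule IsTrace
  IsTrace-post (eval {skip} p)     = skip (≈-trans p (run-skip _))
  IsTrace-post (eval {s₀ ⨾ s₁} p)  = seq (eval ≈-refl) (eval* (≈-trans p (run-⨾ s₀ s₁ _)))
  IsTrace-post (eval {x := e} p)   =
    assign (≈-trans p (≈-trans (run-⟶ assign) (δ-cong (run-skip _))))
  IsTrace-post (eval {if e then sₜ else sf} {σ} p) with σ ⊨? e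
  ... | yes σ⊨e = if-tt σ⊨e
                    (eval* (≈-trans p (≈-trans (run-⟶ (if-tt σ⊨e)) (≈-sym (▷-δ _ _)))))
  ... | no  σ⊭e = if-ff σ⊭e
                    (eval* (≈-trans p (≈-trans (run-⟶ (if-ff σ⊭e)) (≈-sym (▷-δ _ _)))))
  IsTrace-post (eval {while e do′ sₜ} {σ} p) with σ ⊨? e
  -- The intermediate resumption is `δ (run (sₜ , σ))`: the `δ` of the test followed by the trace of
  -- the body.
  ... | yes σ⊨e = while-tt σ⊨e (eval* (≈-sym (▷-δ _ _)))
                    (eval* (≈-trans p (≈-trans (run-while sₜ σ⊨e) (≈-sym (▷-δ _ _)))))
  ... | no  σ⊭e = while-ff σ⊭e
                    (≈-trans p (≈-trans (run-⟶ (while-ff σ⊭e)) (δ-cong (run-skip σ))))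
  IsTrace-post (eval {input x} p)  =
    input (≈-trans p (≈-trans (run-⟶ input) (in-cong λ _ → run-skip _)))
  IsTrace-post (eval {output e} p) =
    output (≈-trans p (≈-trans (run-⟶ output) (out-cong (run-skip _))))
  IsTrace-post (eval* {s} {r} {r′} p) = extend (unfold r) (fold-unfold r)
    where
    extend : ∀ l → r ≈ fold l → Eval-Rule IsTrace (eval* (s , r) r′)
    extend (retᴸ σ)    q = ret* q (eval (≈-trans p (▷-cong s q)))
    extend (inᴸ f)     q =
      in* q (≈-trans p (≈-trans (▷-cong s q) (▷-in f s))) λ _ → eval* ≈-refl
    extend (outᴸ v r₀) q =
      out* q (≈-trans p (≈-trans (▷-cong s q) (▷-out v r₀ s))) (eval* ≈-refl)
    extend (δᴸ r₀)     q =
      δ* q (≈-trans p (≈-trans (▷-cong s q) (▷-δ r₀ s))) (eval* ≈-refl)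

  ⇒-run : ∀ c → c ⇒ run c
  ⇒-run c = IsTrace , IsTrace-post , eval ≈-refl

  ret≉δ : ∀ {ℓ} {A : Set ℓ} {r r₀ σ} → r ≈ ret σ → r ≈ δ r₀ → A
  ret≉δ p q with ≈⇒≈-Rule (≈-trans (≈-sym p) q)
  ... | ()

  in≉δ : ∀ {ℓ} {A : Set ℓ} {r r₀ f} → r ≈ in′ f → r ≈ δ r₀ → A
  in≉δ p q with ≈⇒≈-Rule (≈-trans (≈-sym p) q)
  ... | ()

  out≉δ : ∀ {ℓ} {A : Set ℓ} {r r₀ v r₁} → r ≈ out v r₁ → r ≈ δ r₀ → A
  out≉δ p q with ≈⇒≈-Rule (≈-trans (≈-sym p) q)
  ... | ()

  δ-injective : ∀ {r r∗ r₀} → r₀ ≈ δ r → r₀ ≈ δ r∗ → r ≈ r∗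
  δ-injective p q with ≈⇒≈-Rule (≈-trans (≈-sym p) q)
  ... | δ≈ eq = ≈[]⇒≈ eq

  module _ {R : Pred Judgement (lsuc 0ℓ)} (R-post : R ⊆ Eval-Rule R) where

    -- The root of `r` excludes every rule but `δ*`, so the delay passes to the result. This makes
    -- loops productive.
    eval*-δ : ∀ {s r r₀ r′} → r ≈ δ r₀ → R (eval* (s , r) r′) →
              ∃[ r₁ ] ∃[ r₁′ ] (r₁ ≈ r₀) × (r′ ≈ δ r₁′) × R (eval* (s , r₁) r₁′)
    eval*-δ p x with R-post x
    ... | ret* q _      = ret≉δ q p
    ... | in* q _ _     = in≉δ q p
    ... | out* q _ _    = out≉δ q p
    ... | δ* q q′ y     = _ , _ , δ-injective q p , q′ , y

    -- Lexicographic induction on (n, s).  A loop never evaluates itself at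
    -- the same n: its body starts from a δ, which reaches the outer loop.

    eval⇒≈[]       : ∀ n s {σ r} → R (eval (s , σ) r) → r ≈[ n ] run (s , σ)
    eval*⇒≈[]      : ∀ n s {r r′} → R (eval* (s , r) r′) → r′ ≈[ n ] r ▷ s
    eval-Rule⇒≈[]  : ∀ n s {σ r} → Eval-Rule R (eval (s , σ) r) → r ≈[ n ] run (s , σ)
    eval*-Rule⇒≈[] : ∀ n s {r r′} → Eval-Rule R (eval* (s , r) r′) → r′ ≈[ n ] r ▷ s

    eval⇒≈[]  n s x = eval-Rule⇒≈[] n s (R-post x)
    eval*⇒≈[] n s x = eval*-Rule⇒≈[] n s (R-post x)

    eval-Rule⇒≈[] zero _ _ = zero
    eval-Rule⇒≈[] n@(suc _) _ (assign p) =
      ≈⇒≈[] (≈-trans p (≈-sym (≈-trans (run-⟶ assign) (δ-cong (run-skip _))))) n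
    eval-Rule⇒≈[] n@(suc _) _ (skip p) = ≈⇒≈[] (≈-trans p (≈-sym (run-skip _))) n
    eval-Rule⇒≈[] n@(suc _) (s₀ ⨾ s₁) (seq y z) =
      ≈[]-trans (eval*⇒≈[] n s₁ z)
        (≈[]-trans (▷-cong[] s₁ (eval⇒≈[] n s₀ y))
          (≈[]-sym (≈⇒≈[] (run-⨾ s₀ s₁ _) n)))
    eval-Rule⇒≈[] n@(suc _) (if _ then sₜ else _) (if-tt σ⊨e y) =
      ≈[]-trans (eval*⇒≈[] n sₜ y)
        (≈⇒≈[] (≈-trans (▷-δ _ _) (≈-sym (run-⟶ (if-tt σ⊨e)))) n)
    eval-Rule⇒≈[] n@(suc _) (if _ then _ else sf) (if-ff σ⊭e y) =
      ≈[]-trans (eval*⇒≈[] n sf y)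
        (≈⇒≈[] (≈-trans (▷-δ _ _) (≈-sym (run-⟶ (if-ff σ⊭e)))) n)
    eval-Rule⇒≈[] (suc n) s@(while _ do′ sₜ) (while-tt σ⊨e y z) =
      -- The first inversion strips the `δ` of the test from the body's evaluation, the second
      -- strips it from the loop's. The rest is compared at `n`, and `δ-cong[]` restores `suc n`.
      let _ , _ , r₁≈ret , r≈δ , y₁   = eval*-δ ≈-refl y
          _ , _ , r₂≈r₁′ , r′≈δ , z₂ = eval*-δ r≈δ z
          r₁′≈run = ≈[]-trans (eval*⇒≈[] n sₜ y₁) (≈⇒≈[] (▷-cong sₜ r₁≈ret) n)
          r₂≈run  = ≈[]-trans (≈⇒≈[] r₂≈r₁′ n) r₁′≈run
      in ≈[]-trans (≈⇒≈[] r′≈δ (suc n))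
           (≈[]-trans (δ-cong[] (≈[]-trans (eval*⇒≈[] n s z₂) (▷-cong[] s r₂≈run)))
             (≈⇒≈[] (≈-sym (run-while sₜ σ⊨e)) (suc n)))
    eval-Rule⇒≈[] n@(suc _) _ (while-ff σ⊭e p) =
      ≈⇒≈[] (≈-trans p (≈-sym (≈-trans (run-⟶ (while-ff σ⊭e)) (δ-cong (run-skip _))))) n
    eval-Rule⇒≈[] n@(suc _) _ (input p) =
      ≈⇒≈[] (≈-trans p (≈-sym (≈-trans (run-⟶ input) (in-cong λ _ → run-skip _)))) n
    eval-Rule⇒≈[] n@(suc _) _ (output p) =
      ≈⇒≈[] (≈-trans p (≈-sym (≈-trans (run-⟶ output) (out-cong (run-skip _))))) n

    eval*-Rule⇒≈[] zero _ _ = zero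
    -- Neither `n` nor `s` shrinks here, but every call from `eval` back to `eval*` decreases one of
    -- them.
    eval*-Rule⇒≈[] n@(suc _) s (ret* p y) =
      ≈[]-trans (eval⇒≈[] n s y) (≈⇒≈[] (▷-cong s (≈-sym p)) n)
    eval*-Rule⇒≈[] (suc n) s (in* p q y) =
      ≈[]-trans (≈⇒≈[] q (suc n))
        (≈[]-trans (suc (in≈ λ v → eval*⇒≈[] n s (y v)))
          (≈⇒≈[] (▷-cong s (≈-sym p)) (suc n)))
    eval*-Rule⇒≈[] (suc n) s (out* p q y) =
      ≈[]-trans (≈⇒≈[] q (suc n))
        (≈[]-trans (suc (out≈ (eval*⇒≈[] n s y)))
          (≈⇒≈[] (▷-cong s (≈-sym p)) (suc n)))
    eval*-Rule⇒≈[] (suc n) s (δ* p q y) =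
      ≈[]-trans (≈⇒≈[] q (suc n))
        (≈[]-trans (suc (δ≈ (eval*⇒≈[] n s y)))
          (≈⇒≈[] (▷-cong s (≈-sym p)) (suc n)))

  ⇒⇒≈run : ∀ {s σ r} → (s , σ) ⇒ r → r ≈ run (s , σ)
  ⇒⇒≈run {s} (R , R-post , x) = ≈[]⇒≈ λ n → eval⇒≈[] R-post n s x

  -- Convergence and weak bisimilarity

  -- Indexed by both layer and label, so that matching with one of them known determines the
  -- constructor of the other and removes the mismatched cases.
  data RunsTo : Layer Res → Labelled → Set₁ where
    retʳ : ∀ {σ} → RunsTo (retᴸ σ) (retᶜ σ)
    inʳ  : ∀ {f s g} → (∀ v → f v ≈ run (s , g v)) → RunsTo (inᴸ f) (inᶜ s g)
    outʳ : ∀ {v r s σ} → r ≈ run (s , σ) → RunsTo (outᴸ v r) (outᶜ v s σ)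
    δʳ   : ∀ {r s σ} → r ≈ run (s , σ) → RunsTo (δᴸ r) (δᶜ s σ)

  runsTo : ∀ {r} l → r ≈ runᶜ l → RunsTo (unfold r) l
  runsTo l p = invert l (≈⇒≈-Rule p)
    where
    invert : ∀ {m} l → ≈-Rule (λ (r , r∗) → ∀ n → r ≈[ n ] r∗) m (unfold (runᶜ l)) →
             RunsTo m l
    invert (retᶜ σ)     ret≈     = retʳ
    invert (inᶜ s g)    (in≈ q)  = inʳ λ v → ≈[]⇒≈ (q v)
    invert (outᶜ v s σ) (out≈ q) = outʳ (≈[]⇒≈ q)
    invert (δᶜ s σ)     (δ≈ q)   = δʳ (≈[]⇒≈ q)

  next-runsTo : ∀ s σ {r r′} → r ≈ r′ → r ≈ run (s , σ) → RunsTo (unfold r′) (next s σ)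
  next-runsTo s σ p q = runsTo _ (≈-trans (≈-sym p) (≈-trans q (run-next s σ)))

  ↓⇒↓ᶜ : ∀ {s σ r r′} → r ≈ run (s , σ) → r ↓ r′ → ∃[ l ] ((s , σ) ↓ᶜ l) × (r′ ≈ runᶜ l)
  -- Abstracting `next s σ` together with its soundness lets the match on `RunsTo` turn the latter
  -- into a step with the required label.
  ↓⇒↓ᶜ {s} {σ} p (ret↓ q q′) with next s σ | next-sound s σ | next-runsTo s σ q p
  ... | _ | step | retʳ = _ , ret↓ step , q′
  ↓⇒↓ᶜ {s} {σ} p (in↓ q q′ f≈) with next s σ | next-sound s σ | next-runsTo s σ q p
  ... | _ | step | inʳ f≈run =
    _ , in↓ step , ≈-trans q′ (in-cong λ v → ≈-trans (≈-sym (f≈ v)) (f≈run v))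
  ↓⇒↓ᶜ {s} {σ} p (out↓ q q′ r≈) with next s σ | next-sound s σ | next-runsTo s σ q p
  ... | _ | step | outʳ r≈run =
    _ , out↓ step , ≈-trans q′ (out-cong (≈-trans (≈-sym r≈) r≈run))
  ↓⇒↓ᶜ {s} {σ} p (δ↓ q r₀↓r′) with next s σ | next-sound s σ | next-runsTo s σ q p
  ... | _ | step | δʳ r₀≈run with ↓⇒↓ᶜ r₀≈run r₀↓r′
  ...   | l , c↓l , r′≈ = l , δ↓ step c↓l , r′≈

  ↓ᶜ⇒↓ : ∀ {c l} → c ↓ᶜ l → run c ↓ runᶜ l
  ↓ᶜ⇒↓ (ret↓ step)     = ret↓ (run-⟶ step) ≈-refl
  ↓ᶜ⇒↓ (out↓ step)     = out↓ (run-⟶ step) ≈-refl ≈-refl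
  ↓ᶜ⇒↓ (in↓ step)      = in↓ (run-⟶ step) ≈-refl λ _ → ≈-refl
  ↓ᶜ⇒↓ (δ↓ step c↓l) = δ↓ (run-⟶ step) (↓ᶜ⇒↓ c↓l)

  data Image (R : Pred (Config × Config) (lsuc 0ℓ)) : Pred (Res × Res) (lsuc 0ℓ) where
    image : ∀ {c c∗} → R (c , c∗) → Image R (run c , run c∗)

  -- Closed under `_≈_` because the children reached by convergence are traces only up to
  -- bisimilarity.
  data Preimage (R : Pred (Res × Res) (lsuc 0ℓ)) : Pred (Config × Config) (lsuc 0ℓ) where
    preimage : ∀ {c c∗ r r∗} → r ≈ run c → r∗ ≈ run c∗ → R (r , r∗) → Preimage R (c , c∗)

  Image-post : ∀ {R} → R ⊆ ≅ᶜ-Rule R → Image R ⊆ ≅-Rule (Image R)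
  Image-post R-post (image x) with R-post x
  ... | ret≅ p q   = ret≅ (↓ᶜ⇒↓ p) (↓ᶜ⇒↓ q)
  ... | in≅ p q y  = in≅ (↓ᶜ⇒↓ p) (↓ᶜ⇒↓ q) λ v → image (y v)
  ... | out≅ p q y = out≅ (↓ᶜ⇒↓ p) (↓ᶜ⇒↓ q) (image y)
  ... | δ≅ p q y   = δ≅ (run-⟶ p) (run-⟶ q) (image y)

  Preimage-post : ∀ {R} → R ⊆ ≅-Rule R → Preimage R ⊆ ≅ᶜ-Rule (Preimage R)
  Preimage-post R-post (preimage {s , σ} {s∗ , σ∗} p p∗ x) with R-post x
  ... | ret≅ r↓ r∗↓ with ↓⇒↓ᶜ p r↓ | ↓⇒↓ᶜ p∗ r∗↓
  -- The resumptions converge to the same `ret σ`, which forces both labels to be `retᶜ σ`.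
  ...   | l , c↓ , q | l∗ , c∗↓ , q∗ with runsTo l q | runsTo l∗ q∗
  ...     | retʳ | retʳ = ret≅ c↓ c∗↓
  Preimage-post R-post (preimage {s , σ} {s∗ , σ∗} p p∗ x) | in≅ r↓ r∗↓ y
    with ↓⇒↓ᶜ p r↓ | ↓⇒↓ᶜ p∗ r∗↓
  ...   | l , c↓ , q | l∗ , c∗↓ , q∗ with runsTo l q | runsTo l∗ q∗
  ...     | inʳ f≈ | inʳ f∗≈ = in≅ c↓ c∗↓ λ v → preimage (f≈ v) (f∗≈ v) (y v)
  Preimage-post R-post (preimage {s , σ} {s∗ , σ∗} p p∗ x) | out≅ r↓ r∗↓ y
    with ↓⇒↓ᶜ p r↓ | ↓⇒↓ᶜ p∗ r∗↓
  ...   | l , c↓ , q | l∗ , c∗↓ , q∗ with runsTo l q | runsTo l∗ q∗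
  ...     | outʳ r≈ | outʳ r∗≈ = out≅ c↓ c∗↓ (preimage r≈ r∗≈ y)
  Preimage-post R-post (preimage {s , σ} {s∗ , σ∗} p p∗ x) | δ≅ q q∗ y
    with next s σ | next-sound s σ | next-runsTo s σ q p
       | next s∗ σ∗ | next-sound s∗ σ∗ | next-runsTo s∗ σ∗ q∗ p∗
  ... | _ | step | δʳ r≈ | _ | step∗ | δʳ r∗≈ = δ≅ step step∗ (preimage r≈ r∗≈ y)

lemma5p1 : (L : Language) → let open Semantics L in
    (s s∗ : Stmt) (σ σ∗ : State) →
    ((s , σ) ≅ᶜ (s∗ , σ∗)) ⇔
    (∃[ r ] ∃[ r∗ ] ((s , σ) ⇒ r) × ((s∗ , σ∗) ⇒ r∗) × (r ≅ r∗))
lemma5p1 L s s∗ σ σ∗ = mk⇔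
  (λ (R , R-post , x) →
    run (s , σ) , run (s∗ , σ∗) , ⇒-run (s , σ) , ⇒-run (s∗ , σ∗) ,
    Image R , Image-post R-post , image x)
  (λ (r , r∗ , c⇒r , c∗⇒r∗ , R , R-post , x) →
    Preimage R , Preimage-post R-post , preimage (⇒⇒≈run c⇒r) (⇒⇒≈run c∗⇒r∗) x)
  where open Traces L
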